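{- Let $d$ be a Dyck number and let $r$ be the length of the repunit suffix in the binary expansion of $d$. Then: 1. if $r = 0$, then $DS(d) = 1$; 2. if $r = 1$ or $r = 2$, then $DS(d) = d + 2$; 3. otherwise (i.e. $r \ge 3$), $DS(d) = d + 2^{\,r-1-\lfloor h/2 \rfloor}$, where $h$ is the valley depth (height of the deepest valley) of the binary string obtained from the binary expansion of $d$ by swapping the rightmost digit $0$ with the digit $1$ immediately to its right (the highest digit of the repunit suffix).
   Context: A Dyck number is a natural number in whose binary expansion (written without leading zeros) every suffix (final fragment, i.e. block of least significant digits) contains at most as many digits $0$ as digits $1$. By convention $0$ is also a Dyck number (its repunit suffix has length $0$). In increasing order the Dyck numbers are $0, 1, 3, 5, 7, 11, 13, 15, 19, 21, 23, 27, 29, 31, 39, \dots$ (OEIS A036991). The Dyck successor function $DS$ sends a Dyck number $d$ to the next one, i.e. $DS(d)$ is the smallest Dyck number strictly greater than $d$. The repunit suffix of $d$ is the maximal block of consecutive digits $1$ at the right (least significant) end of its binary expansion; $r$ is its length. For a binary string, the height of a digit is the number of $1$'s minus the number of $0$'s in the suffix that begins at that digit (the digit itself included) and extends to the right end of the string; so a rightmost digit $1$ has height $1$. A valley is a digit $0$ whose immediate left neighbour is a digit $1$, and the height of the valley is the height of that digit $0$. The valley depth of a string is the smallest height of a valley in it. If $d = 2^n - 1$ is a Mersenne number (its binary expansion consists only of $1$'s, so $r = n$), one leading zero is inserted at the beginning of the binary expansion before the swap, so that the swap turns $0\,1^r$ into $1\,0\,1^{r-1}$. In all other cases with $r\ge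 1$ the swap replaces the ending $0\,1^r$ of the binary expansion by $1\,0\,1^{r-1}$. -}

module Defs where

open import Data.Digit using (Expansion; fromDigits)
open import Data.Fin using (zero; suc; _≟_)
open import Data.Integer as ℤ using (ℤ; _⊖_)
open import Data.List using ([]; _∷_; _++_; _∷ʳ_; filter; last; length; take; takeWhile)
open import Data.Maybe using (just)
open import Data.Nat using (ℕ; zero; suc; _*_; _≤_; _<_)
open import Data.Product using (_×_; ∃₂)
open import Level using (0ℓ)
open import Relation.Binary using (Rel)
open import Relation.Binary.PropositionalEquality
  using (_≡_; _≢_; refl; sym; trans; cong)
open import Relation.Unary using (Pred)

pattern 0b = zero
pattern 1b = suc zero

-- Binary strings are stored least significant digit first, as in Data.Digit:
-- the head of the list is the rightmost digit, the left neighbour of a digit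
-- is the next element of the list, and the suffixes of a string are the
-- initial segments of the list.
BinaryString : Set
BinaryString = Expansion 2

increment : BinaryString → BinaryString
increment []       = 1b ∷ []
increment (0b ∷ w) = 1b ∷ w
increment (1b ∷ w) = 0b ∷ increment w

-- The expansion without leading zeros; in particular 0 has the empty
-- expansion.  Counting up is used instead of toDigits, whose well-founded
-- recursion does not unfold at a variable.
binary : ℕ → BinaryString
binary zero    = []
binary (suc n) = increment (binary n)

fromDigits-binary : ∀ n → fromDigits (binary n) ≡ n
fromDigits-binary zero    = refl
fromDigits-binary (suc n) = trans (lemma (binary n)) (cong suc (fromDigits-binary n))
  where
  lemma : ∀ w → fromDigits (increment w) ≡ suc (fromDigits w)
  lemma []       = refl
  lemma (0b ∷ w) = refl
  lemma (1b ∷ w) = cong (_* 2) (lemma w)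

binary-noLeadingZero : ∀ n → last (binary n) ≢ just 0b
binary-noLeadingZero zero    = λ ()
binary-noLeadingZero (suc n) = lemma (binary n) (binary-noLeadingZero n)
  where
  skip : ∀ b w → last (b ∷ increment w) ≡ last (increment w)
  skip b []       = refl
  skip b (0b ∷ w) = refl
  skip b (1b ∷ w) = refl

  lemma : ∀ w → last w ≢ just 0b → last (increment w) ≢ just 0b
  lemma []           _ = λ ()
  lemma (0b ∷ [])    _ = λ ()
  lemma (0b ∷ _ ∷ _) p = p
  lemma (1b ∷ [])    _ = λ ()
  lemma (1b ∷ w@(_ ∷ _)) p = λ q → lemma w p (trans (sym (skip 0b w)) q)

#0 #1 : BinaryString → ℕ
#0 w = length (filter (_≟ 0b) w)
#1 w = length (filter (_≟ 1b) w)

-- take k w is the suffix consisting of the last k digits.  The number 0 is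
-- Dyck because its expansion is empty.
Dyck : ℕ → Set
Dyck d = ∀ k → #0 (take k (binary d)) ≤ #1 (take k (binary d))

IsLeast : {A : Set} → Rel A 0ℓ → Pred A 0ℓ → A → Set
IsLeast _≼_ P x = P x × (∀ y → P y → x ≼ y)

infix 4 DS[_]=_

-- The graph of the Dyck successor function.
DS[_]=_ : ℕ → ℕ → Set
DS[ d ]= m = IsLeast _≤_ (λ n → Dyck n × d < n) m

repunitLength : BinaryString → ℕ
repunitLength w = length (takeWhile (_≟ 1b) w)

-- The height of the leftmost digit of s in any string that has s as a suffix.
height : BinaryString → ℤ
height s = #1 s ⊖ #0 s

ValleyHeight : BinaryString → ℤ → Set
ValleyHeight w h = ∃₂ λ u v → w ≡ u ++ 0b ∷ 1b ∷ v × h ≡ height (u ∷ʳ 0b)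

ValleyDepth : BinaryString → ℤ → Set
ValleyDepth w = IsLeast ℤ._≤_ (ValleyHeight w)

-- Turns the ending 0 1^r into 1 0 1^(r-1).  For the string 1^r the clause for
-- 1b ∷ [] supplies the leading zero and swaps it at once.  The first two
-- clauses cover r = 0, where there is nothing to swap.
swap : BinaryString → BinaryString
swap []            = []
swap (0b ∷ w)      = 0b ∷ w
swap (1b ∷ [])     = 0b ∷ 1b ∷ []
swap (1b ∷ 0b ∷ w) = 0b ∷ 1b ∷ w
swap (1b ∷ 1b ∷ w) = 1b ∷ swap (1b ∷ w)

{-# OPTIONS --safe #-}
module Submission where

-- Read a binary string from its right end as a walk, going up at a digit 1 and
-- down at a digit 0, and let its demand be the least starting level from which
-- the walk never goes below 0.  A number is Dyck iff its expansion has demand 0,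
-- and in a string 0 1 ... without leading zeros the lowest point of the walk
-- is a valley, so the valley depth of 1^m 0 1 A (least significant digit first)
-- is m - demand (0 1 A).
--
-- If d = 1^r 0 A, then d + 1 = 0^r 1 A.  Write r = e + z.  Counting on from
-- 0^e 0^z 1 A, the digits 0^z 1 A stay fixed until 1^e 0^z 1 A = d + 2^e is
-- reached, and every number before that has a 0 among its last e digits, so it
-- lifts the walk to height at most e - 2 before 0^z 1 A is read.  Hence d + 2^e
-- is the first Dyck number after d if demand (0^z 1 A) is e or e - 1.

open import Defs
open import Data.Digit using (fromDigits)
open import Data.Empty using (⊥-elim)
open import Data.Fin using (Fin)
open import Data.Integer as ℤ using (ℤ; +_; _/ℕ_; _⊖_)
import Data.Integer.Properties as ℤ
open import Data.List using ([]; _∷_; _++_; _∷ʳ_; last; length; replicate; take)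
open import Data.List.Properties using (++-assoc; ∷-injectiveʳ)
open import Data.Maybe using (just)
open import Data.Nat using (ℕ; zero; suc; pred; _+_; _*_; _∸_; _^_; _≤_; _<_; _≥_; z≤n; s≤s; s≤s⁻¹; _/_; _%_)
open import Data.Nat.DivMod using (m≡m%n+[m/n]*n; m%n<n)
open import Data.Nat.Properties
open import Data.Nat.Tactic.RingSolver using (solve-∀)
open import Data.Product using (_×_; ∃; ∃₂; _,_; proj₂)
open import Data.Sum using (_⊎_; inj₁; inj₂)
open import Relation.Binary.Definitions using (tri<; tri≈; tri>)
open import Relation.Binary.PropositionalEquality using (_≡_; _≢_; refl; sym; trans; cong; cong₂; subst; subst₂; module ≡-Reasoning)

-- Demand of a walk and the Dyck condition.

ones zeros : ℕ → BinaryString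
ones n  = replicate n 1b
zeros n = replicate n 0b

-- A first step up lowers the demand of the rest by one; `pred` truncates because a starting level
-- is never negative.
demand : BinaryString → ℕ
demand []       = 0
demand (0b ∷ s) = suc (demand s)
demand (1b ∷ s) = pred (demand s)

demand-ones++ : ∀ n s → demand (ones n ++ s) ≡ demand s ∸ n
demand-ones++ zero    s = refl
demand-ones++ (suc n) s = trans (cong pred (demand-ones++ n s)) (pred[m∸n]≡m∸[1+n] (demand s) n)

demand-zeros++ : ∀ n s → demand (zeros n ++ s) ≡ n + demand s
demand-zeros++ zero    s = refl
demand-zeros++ (suc n) s = cong suc (demand-zeros++ n s)

n≤1+pred[n] : ∀ n → n ≤ suc (pred n)
n≤1+pred[n] zero    = z≤n
n≤1+pred[n] (suc n) = ≤-refl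

-- With `demand-least`, this identifies `demand s` as the least admissible starting level.
#0-take≤ : ∀ k s → #0 (take k s) ≤ demand s + #1 (take k s)
#0-take≤ zero    s        = z≤n
#0-take≤ (suc k) []       = z≤n
#0-take≤ (suc k) (0b ∷ s) = s≤s (#0-take≤ k s)
#0-take≤ (suc k) (1b ∷ s) = begin
  #0 (take k s)                           ≤⟨ #0-take≤ k s ⟩
  demand s + #1 (take k s)                ≤⟨ +-monoˡ-≤ _ (n≤1+pred[n] (demand s)) ⟩
  suc (pred (demand s) + #1 (take k s))   ≡⟨ +-suc _ _ ⟨
  pred (demand s) + suc (#1 (take k s))   ∎
  where open ≤-Reasoning

demand-least : ∀ s g → (∀ k → #0 (take k s) ≤ g + #1 (take k s)) → demand s ≤ g
demand-least []       g       _ = z≤n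
demand-least (0b ∷ s) zero    p with () ← p 1
demand-least (0b ∷ s) (suc g) p = s≤s (demand-least s g (λ k → s≤s⁻¹ (p (suc k))))
demand-least (1b ∷ s) g       p =
  pred-mono-≤ (demand-least s (suc g) (λ k → subst (#0 (take k s) ≤_) (+-suc g _) (p (suc k))))

Dyck⇒demand≡0 : ∀ n → Dyck n → demand (binary n) ≡ 0
Dyck⇒demand≡0 n p = n≤0⇒n≡0 (demand-least (binary n) 0 p)

demand≡0⇒Dyck : ∀ n → demand (binary n) ≡ 0 → Dyck n
demand≡0⇒Dyck n p k = subst (λ g → #0 (take k (binary n)) ≤ g + #1 (take k (binary n))) p (#0-take≤ k (binary n))

-- Counting up from a block of zeros.

increment-ones : ∀ e s → increment (ones e ++ 0b ∷ s) ≡ zeros e ++ 1b ∷ s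
increment-ones zero    s = refl
increment-ones (suc e) s = cong (0b ∷_) (increment-ones e s)

zeros++0 : ∀ e s → zeros (suc e) ++ s ≡ zeros e ++ 0b ∷ s
zeros++0 zero    s = refl
zeros++0 (suc e) s = cong (0b ∷_) (zeros++0 e s)

ones++1 : ∀ e s → ones (suc e) ++ s ≡ ones e ++ 1b ∷ s
ones++1 zero    s = refl
ones++1 (suc e) s = cong (1b ∷_) (ones++1 e s)

zeros-+ : ∀ e z s → zeros (e + z) ++ s ≡ zeros e ++ (zeros z ++ s)
zeros-+ zero    z s = refl
zeros-+ (suc e) z s = cong (0b ∷_) (zeros-+ e z s)

n+2^1+e : ∀ n e → n + 2 ^ e + 2 ^ e ≡ n + 2 ^ suc e
n+2^1+e n e = lemma n (2 ^ e)
  where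
  lemma : ∀ a b → a + b + b ≡ a + (b + (b + 0))
  lemma = solve-∀

-- By halves: filling the lower `e` zeros and adding 1 moves a 1 into the next digit (`carry`) and
-- clears the lower ones, which are then filled again.
count-to-ones : ∀ e n p s → binary n ≡ zeros e ++ s → suc p ≡ n + 2 ^ e → binary p ≡ ones e ++ s
carry : ∀ e n s → binary n ≡ zeros (suc e) ++ s → binary (n + 2 ^ e) ≡ zeros e ++ 1b ∷ s

count-to-ones zero    n p s n≡ p≡ =
  trans (cong binary (suc-injective (trans p≡ (+-comm n 1)))) n≡
count-to-ones (suc e) n p s n≡ p≡ =
  trans (count-to-ones e (n + 2 ^ e) p (1b ∷ s) (carry e n s n≡) (trans p≡ (sym (n+2^1+e n e))))
        (sym (ones++1 e s))

carry e n s n≡ with n + 2 ^ e in eq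
... | zero  = ⊥-elim (<⇒≢ (m^n>0 2 e) (sym (m+n≡0⇒n≡0 n eq)))
... | suc p = trans (cong increment (count-to-ones e n p (0b ∷ s) (trans n≡ (zeros++0 e s)) (sym eq)))
                    (increment-ones e s)

-- The strict bound on `suc y` leaves out the number with `e` final ones. The induction splits on
-- the highest digit of the block.
demand-while-counting : ∀ e n y s → binary n ≡ zeros e ++ s → n ≤ y → suc y < n + 2 ^ e →
                        2 + demand s ≤ e + demand (binary y)
demand-while-counting zero n y s n≡ n≤y y< =
  ⊥-elim (<⇒≱ (s≤s⁻¹ (≤-trans y< (≤-reflexive (+-comm n 1)))) n≤y)
demand-while-counting (suc e) n y s n≡ n≤y y< with <-cmp (suc y) (n + 2 ^ e)
... | tri< y<mid _ _ = m≤n⇒m≤1+n (≤-trans (n≤1+n _)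
        (demand-while-counting e n y (0b ∷ s) (trans n≡ (zeros++0 e s)) n≤y y<mid))
-- Just before the carry the lower digits are all 1, which the induction hypothesis excludes; here
-- the demand is computed directly.
... | tri≈ _ y≡mid _ = s≤s (subst (suc (demand s) ≤_) (cong (λ k → e + k) (sym lemma)) (m≤n+m∸n (suc (demand s)) e))
  where
  lemma : demand (binary y) ≡ suc (demand s) ∸ e
  lemma = trans (cong demand (count-to-ones e n y (0b ∷ s) (trans n≡ (zeros++0 e s)) y≡mid))
                (demand-ones++ e (0b ∷ s))
... | tri> _ _ mid<y = s≤s (≤-trans (s≤s (n≤1+pred[n] (demand s)))
        (demand-while-counting e (n + 2 ^ e) y (1b ∷ s) (carry e n s n≡) (s≤s⁻¹ mid<y)
          (subst (suc y <_) (sym (n+2^1+e n e)) y<)))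

-- The first inequality makes `d + 2 ^ e` Dyck; the second excludes every number strictly between.
DS-zeros : ∀ d e z s → binary (suc d) ≡ zeros (e + z) ++ s →
           z + demand s ≤ e → e ≤ suc (z + demand s) → DS[ d ]= d + 2 ^ e
DS-zeros d e z s d+1≡ demand≤e e≤1+demand =
  (demand≡0⇒Dyck (d + 2 ^ e) dyck , m<m+n d (m^n>0 2 e)) , least
  where
  t : BinaryString
  t = zeros z ++ s

  start : binary (suc d) ≡ zeros e ++ t
  start = trans d+1≡ (zeros-+ e z s)

  dyck : demand (binary (d + 2 ^ e)) ≡ 0
  dyck = begin
    demand (binary (d + 2 ^ e))  ≡⟨ cong demand (count-to-ones e (suc d) _ t start refl) ⟩
    demand (ones e ++ t)         ≡⟨ demand-ones++ e t ⟩
    demand t ∸ e                 ≡⟨ cong (_∸ e) (demand-zeros++ z s) ⟩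
    z + demand s ∸ e             ≡⟨ m≤n⇒m∸n≡0 demand≤e ⟩
    0                            ∎
    where open ≡-Reasoning

  least : ∀ y → Dyck y × d < y → d + 2 ^ e ≤ y
  least y (dy , d<y) = ≮⇒≥ λ y<m → <⇒≱ (s≤s e≤1+demand)
    (subst₂ _≤_ (cong (λ k → 2 + k) (demand-zeros++ z s))
                (trans (cong (λ k → e + k) (Dyck⇒demand≡0 y dy)) (+-identityʳ e))
                (demand-while-counting e (suc d) y t start d<y (s≤s y<m)))

-- Repunit suffix and swap.

no-repunit : ∀ w → demand w ≡ 0 → repunitLength w ≡ 0 → w ≡ []
no-repunit []       _  _  = refl
no-repunit (0b ∷ w) () _
no-repunit (1b ∷ w) _  ()

-- The same `s` describes successor and swap. A Mersenne number has `s = []`, as if its leading zero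
-- were written.
split-repunit : ∀ w m → repunitLength w ≡ suc m → ∃ λ s →
  increment w ≡ zeros (suc m) ++ 1b ∷ s × swap w ≡ ones m ++ 0b ∷ 1b ∷ s × demand w ≡ demand s ∸ m
split-repunit (1b ∷ [])     zero    _  = [] , refl , refl , refl
split-repunit (1b ∷ 0b ∷ s) zero    _  = s , refl , refl , refl
split-repunit (1b ∷ 1b ∷ w) (suc m) r≡
  with s , inc≡ , swap≡ , demand≡ ← split-repunit (1b ∷ w) m (suc-injective r≡)
  = s , cong (0b ∷_) inc≡ , cong (1b ∷_) swap≡
      , trans (cong pred demand≡) (pred[m∸n]≡m∸[1+n] (demand s) m)

-- Valley depth.

last-++-∷ : ∀ (xs : BinaryString) y ys → last (xs ++ y ∷ ys) ≡ last (y ∷ ys)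
last-++-∷ []           y ys = refl
last-++-∷ (x ∷ [])     y ys = refl
last-++-∷ (x ∷ z ∷ xs) y ys = last-++-∷ (z ∷ xs) y ys

tail-noLeadingZero : ∀ (b : Fin 2) (s : BinaryString) → last (b ∷ s) ≢ just 0b → last s ≢ just 0b
tail-noLeadingZero b []      p ()
tail-noLeadingZero b (_ ∷ _) p = p

-- A lowest point below the start is reached by a 0; the leading digit being 1, the walk goes on,
-- and it can only go up.
deepest-valley : ∀ s → last s ≢ just 0b → demand s ≡ 0 ⊎
  ∃₂ λ u v → s ≡ u ++ 0b ∷ 1b ∷ v × #0 (u ∷ʳ 0b) ≡ demand s + #1 (u ∷ʳ 0b)
deepest-valley [] _ = inj₁ refl
deepest-valley (0b ∷ s) p with deepest-valley s (tail-noLeadingZero 0b s p)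
deepest-valley (0b ∷ [])     p | inj₁ _ = ⊥-elim (p refl)
deepest-valley (0b ∷ 1b ∷ v) p | inj₁ d≡0 = inj₂ ([] , v , refl , cong suc (sym (trans (+-identityʳ _) d≡0)))
... | inj₂ (u , v , s≡ , h≡) = inj₂ (0b ∷ u , v , cong (0b ∷_) s≡ , cong suc h≡)
deepest-valley (1b ∷ s) p with deepest-valley s (tail-noLeadingZero 1b s p)
... | inj₁ d≡0 = inj₁ (cong pred d≡0)
... | inj₂ (u , v , s≡ , h≡) with demand s
-- The valley found in `s` is at level 0 there, so the extra step up lifts it above the start.
...   | zero  = inj₁ refl
...   | suc g = inj₂ (1b ∷ u , v , cong (1b ∷_) s≡ , trans h≡ (sym (+-suc g _)))

#0-ones++ : ∀ m s → #0 (ones m ++ s) ≡ #0 s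
#0-ones++ zero    s = refl
#0-ones++ (suc m) s = #0-ones++ m s

#1-ones++ : ∀ m s → #1 (ones m ++ s) ≡ m + #1 s
#1-ones++ zero    s = refl
#1-ones++ (suc m) s = cong suc (#1-ones++ m s)

take-length-∷ : ∀ (u : BinaryString) b v → take (suc (length u)) (u ++ b ∷ v) ≡ u ∷ʳ b
take-length-∷ []      b v = refl
take-length-∷ (a ∷ u) b v = cong (a ∷_) (take-length-∷ u b v)

-- The 0 cannot lie among the ones, so it lies in `s`, where `#0-take≤` bounds the descent.
valley-bound : ∀ m s u v → ones m ++ s ≡ u ++ 0b ∷ v → m + #0 (u ∷ʳ 0b) ≤ demand s + #1 (u ∷ʳ 0b)
valley-bound zero    s u v refl = subst (λ t → #0 t ≤ demand s + #1 t) (take-length-∷ u 0b v) (#0-take≤ (suc (length u)) s)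
valley-bound (suc m) s (1b ∷ u) v eq =
  subst (suc (m + #0 (u ∷ʳ 0b)) ≤_) (sym (+-suc _ _)) (s≤s (valley-bound m s u v (∷-injectiveʳ eq)))

valleyDepth : ∀ η s → last (1b ∷ s) ≢ just 0b →
  let t = 0b ∷ 1b ∷ s in ValleyDepth (ones (η + demand t) ++ t) (+ η)
valleyDepth η s p with deepest-valley (0b ∷ 1b ∷ s) p
-- Demand 0 is impossible for a string that begins with `0b`.
... | inj₂ (u , v , t≡ , lowest) = (ones m ++ u , v , split , height≡) , least
  where
  t = 0b ∷ 1b ∷ s
  m = η + demand t
  x = u ∷ʳ 0b

  split : ones m ++ t ≡ (ones m ++ u) ++ 0b ∷ 1b ∷ v
  split = trans (cong (ones m ++_) t≡) (sym (++-assoc (ones m) u _))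

  height≡ : + η ≡ height ((ones m ++ u) ∷ʳ 0b)
  height≡ = begin
    + η                                       ≡⟨ ℤ.+-cancelˡ-⊖ (#0 x) η 0 ⟨
    (#0 x + η) ⊖ (#0 x + 0)                   ≡⟨ cong₂ _⊖_ up (+-identityʳ (#0 x)) ⟩
    (m + #1 x) ⊖ #0 x                         ≡⟨ cong₂ _⊖_ (#1-ones++ m x) (#0-ones++ m x) ⟨
    height (ones m ++ x)                      ≡⟨ cong height (++-assoc (ones m) u _) ⟨
    height ((ones m ++ u) ∷ʳ 0b)              ∎
    where
    open ≡-Reasoning
    reorder : ∀ a b c → a + b + c ≡ c + a + b
    reorder = solve-∀
    up : #0 x + η ≡ m + #1 x
    up = trans (cong (_+ η) lowest) (reorder (demand t) (#1 x) η)

  least : ∀ h → ValleyHeight (ones m ++ t) h → + η ℤ.≤ h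
  least _ (u′ , v′ , eq , refl) = begin
    + η                                        ≡⟨ ℤ.+-cancelˡ-⊖ (#0 y) η 0 ⟨
    (#0 y + η) ⊖ (#0 y + 0)                    ≡⟨ cong ((#0 y + η) ⊖_) (+-identityʳ (#0 y)) ⟩
    (#0 y + η) ⊖ #0 y                          ≤⟨ ℤ.⊖-monoˡ-≤ (#0 y) up ⟩
    height y                                   ∎
    where
    open ℤ.≤-Reasoning
    y = u′ ∷ʳ 0b
    reorder : ∀ a b c → a + b + c ≡ b + (c + a)
    reorder = solve-∀
    up : #0 y + η ≤ #1 y
    up = +-cancelˡ-≤ (demand t) _ _
      (subst (_≤ demand t + #1 y) (reorder η (demand t) (#0 y)) (valley-bound m t u′ _ eq))

theorem9 : ∀ (d : ℕ) → Dyck d →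
    let r = repunitLength (binary d) in
    (r ≡ 0 → DS[ d ]= 1)
    × (r ≡ 1 ⊎ r ≡ 2 → DS[ d ]= d + 2)
    × (r ≥ 3 → ∃₂ λ (h : ℤ) (e : ℕ) →
    ValleyDepth (swap (binary d)) h
    × + e ≡ + r ℤ.- + 1 ℤ.- h /ℕ 2
    × DS[ d ]= d + 2 ^ e)
theorem9 d dyck = r≡0⇒ , r≡1⊎2⇒ , r≥3⇒
  where
  r = repunitLength (binary d)

  r≡0⇒ : r ≡ 0 → DS[ d ]= 1
  r≡0⇒ r≡0
    with refl ← trans (sym (fromDigits-binary d))
                      (cong fromDigits (no-repunit (binary d) (Dyck⇒demand≡0 d dyck) r≡0))
    = (demand≡0⇒Dyck 1 refl , s≤s z≤n) , λ _ → proj₂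

  demand≤ : ∀ m s → demand (binary d) ≡ demand s ∸ m → demand s ≤ m
  demand≤ m s eq = m∸n≡0⇒m≤n (trans (sym eq) (Dyck⇒demand≡0 d dyck))

  r≡1⊎2⇒ : r ≡ 1 ⊎ r ≡ 2 → DS[ d ]= d + 2
  r≡1⊎2⇒ (inj₁ r≡1) with s , inc≡ , _ , demand≡ ← split-repunit (binary d) 0 r≡1
    = DS-zeros d 1 0 (1b ∷ s) inc≡
        (≤-trans pred≤0 z≤n) (s≤s z≤n)
    where
    pred≤0 : pred (demand s) ≤ 0
    pred≤0 = pred-mono-≤ (m≤n⇒m≤1+n (demand≤ 0 s demand≡))
  r≡1⊎2⇒ (inj₂ r≡2) with s , inc≡ , _ , demand≡ ← split-repunit (binary d) 1 r≡2
    -- Only the lower of the two zeros is filled: `0 1 s` has demand 1.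
    = DS-zeros d 1 1 (1b ∷ s) inc≡
        (s≤s (pred-mono-≤ (demand≤ 1 s demand≡))) (s≤s z≤n)

  r≥3⇒ : r ≥ 3 → ∃₂ λ (h : ℤ) (e : ℕ) →
    ValleyDepth (swap (binary d)) h
    × + e ≡ + r ℤ.- + 1 ℤ.- h /ℕ 2
    × DS[ d ]= d + 2 ^ e
  r≥3⇒ r≥3 with r | split-repunit (binary d)
  ... | suc m | split with s , inc≡ , swap≡ , demand≡ ← split m refl
    = + η , e , depth , exponent , successor
    where
    g η q e : ℕ
    g = demand (1b ∷ s)
    η = m ∸ suc g
    q = η / 2
    -- This is `m - q`, as `m = η + 1 + g` and `η = η % 2 + 2 q`. It exceeds `suc q + g`, the demand
    -- of `suc q` zeros before `1b ∷ s`, by `η % 2`, hence by 0 or 1.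
    e = suc (η % 2 + q + g)

    -- Makes the subtraction in `η` exact. If `demand s` is 0, so is `g`, and `r ≥ 3` gives the
    -- bound.
    1+g≤m : suc g ≤ m
    1+g≤m = lemma (demand s) (demand≤ m s demand≡) (s≤s⁻¹ r≥3)
      where
      lemma : ∀ a → a ≤ m → 2 ≤ m → suc (pred a) ≤ m
      lemma zero    _   2≤m = <⇒≤ 2≤m
      lemma (suc a) a≤m _   = a≤m

    m≡η+1+g : m ≡ η + suc g
    m≡η+1+g = sym (m∸n+n≡m 1+g≤m)

    1+m≡e+1+q : suc m ≡ e + suc q
    1+m≡e+1+q = trans (cong suc (trans m≡η+1+g (cong (_+ suc g) (m≡m%n+[m/n]*n η 2)))) (reorder (η % 2) q g)
      where
      reorder : ∀ a b c → suc (a + b * 2 + suc c) ≡ suc (a + b + c) + suc b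
      reorder = solve-∀

    noLeadingZero : last (1b ∷ s) ≢ just 0b
    noLeadingZero eq = binary-noLeadingZero (suc d)
      (trans (cong last inc≡) (trans (last-++-∷ (zeros (suc m)) 1b s) eq))

    depth : ValleyDepth (swap (binary d)) (+ η)
    depth = subst (λ w → ValleyDepth w (+ η))
      (trans (cong (λ k → ones k ++ 0b ∷ 1b ∷ s) (sym m≡η+1+g)) (sym swap≡))
      (valleyDepth η s noLeadingZero)

    exponent : + e ≡ + suc m ℤ.- + 1 ℤ.- + q
    exponent = sym (begin
      + m ℤ.- + q           ≡⟨ cong (λ k → + k ℤ.- + q) m≡e+q ⟩
      + (e + q) ℤ.- + q     ≡⟨ ℤ.m-n≡m⊖n (e + q) q ⟩
      (e + q) ⊖ q           ≡⟨ ℤ.⊖-≥ (m≤n+m q e) ⟩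
      + (e + q ∸ q)         ≡⟨ cong +_ (m+n∸n≡m e q) ⟩
      + e                   ∎)
      where
      open ≡-Reasoning
      m≡e+q : m ≡ e + q
      m≡e+q = suc-injective (trans 1+m≡e+1+q (+-suc e q))

    successor : DS[ d ]= d + 2 ^ e
    successor = DS-zeros d e (suc q) (1b ∷ s)
      (trans inc≡ (cong (λ k → zeros k ++ 1b ∷ s) 1+m≡e+1+q))
      (s≤s (+-monoˡ-≤ g (m≤n+m q (η % 2))))
      (s≤s (+-monoˡ-≤ g (+-monoˡ-≤ q (s≤s⁻¹ (m%n<n η 2)))))
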